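{- Consider any instance of the Colored Knapsack Problem (ColKP) with $w_i\le b$ for all items $i\in\mathcal I$ and $p_{\max}=\max\{p_i:i\in\mathcal I\}>0$. There exists an optimal ColKP solution containing no item $i\in\mathcal I$ with $p_i\le-p_{\max}$.
   Context: ColKP instance: items $\mathcal I=\{1,\dots,n\}$, capacity $b\in\mathbb Z_{>0}$, colors $\mathcal C=\{1,\dots,m\}$; each item $i$ has weight $w_i\in\mathbb Z_{>0}$, profit $p_i\in\mathbb Z$ and color $\kappa_i\in\mathcal C$. For $S\subseteq\mathcal I$: $w(S)=\sum_{i\in S}w_i$, $p(S)=\sum_{i\in S}p_i$, $\mathcal I_c=\{i\in\mathcal I:\kappa_i=c\}$, $k_c(S)=|S\cap\mathcal I_c|$, $d(S)=\max_{c\in\mathcal C}k_c(S)$. $S$ is feasible if $w(S)\le b$ and $2d(S)\le|S|+1$. An optimal solution is a feasible $S$ maximizing $p(S)$. -}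

module Defs where

open import Data.Bool.Base using (if_then_else_)
open import Data.Fin.Base using (Fin)
open import Data.Fin.Properties using (_≟_)
open import Data.Fin.Subset using (Subset; _∩_; ∣_∣)
open import Data.Integer.Base as ℤ using (ℤ; 0ℤ)
import Data.Integer.Properties as ℤ
open import Data.Nat.Base as ℕ using (ℕ; suc; NonZero; _+_; _*_; _≤_; _<_)
import Data.Nat.Properties as ℕ
open import Data.Product.Base using (_×_)
open import Data.Vec.Base using (lookup; tabulate)
open import Data.Vec.Functional using (Vector; foldr; head; tail)
open import Relation.Nullary.Decidable.Core using (does)
import Algebra.Properties.CommutativeMonoid.Sum as Sum

private
  module ℕSum = Sum ℕ.+-0-commutativeMonoid
  module ℤSum = Sum ℤ.+-0-commutativeMonoid

record ColKP (n m : ℕ) : Set where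
  field
    b   : ℕ
    b>0 : 0 < b
    w   : Vector ℕ n
    w>0 : ∀ i → 0 < w i
    p   : Vector ℤ n
    κ   : Vector (Fin m) n

  weight : Subset n → ℕ
  weight S = ℕSum.sum (λ i → if lookup S i then w i else 0)

  profit : Subset n → ℤ
  profit S = ℤSum.sum (λ i → if lookup S i then p i else 0ℤ)

  colorClass : Fin m → Subset n
  colorClass c = tabulate (λ i → does (κ i ≟ c))

  k : Fin m → Subset n → ℕ
  k c S = ∣ S ∩ colorClass c ∣

  -- The initial value 0 leaves the maximum unchanged, as the counts are
  -- natural numbers; it matters only if there are no colors at all.
  d : Subset n → ℕ
  d S = foldr ℕ._⊔_ 0 (λ c → k c S)

  Feasible : Subset n → Set
  Feasible S = weight S ≤ b × 2 * d S ≤ ∣ S ∣ + 1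

  Optimal : Subset n → Set
  Optimal S = Feasible S × (∀ T → Feasible T → profit T ℤ.≤ profit S)

-- Profits may all be negative, so the fold starts from an actual entry.
maximum : ∀ {n} .{{_ : NonZero n}} → Vector ℤ n → ℤ
maximum {suc n} v = foldr ℤ._⊔_ (head v) (tail v)

{-# OPTIONS --safe #-}

-- An item of profit at most -p_max can be dropped from an optimal solution
-- at no loss: either alone, or, if dropping it alone makes some color c too
-- frequent, together with one item of color c.  Color c then holds more than
-- half of the remaining items, so dropping one of its items restores the
-- balance, and the pair dropped has total profit at most -p_max + p_max = 0.
-- Repeating this from any optimal solution terminates, as the solution shrinks.

module Submission where

open import Defs
open import Algebra.Bundles using (CommutativeMonoid)
import Algebra.Properties.CommutativeMonoid.Sum as Sum
import Algebra.Properties.CommutativeSemigroup as CommutativeSemigroupProperties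
open import Data.Bool.Base using (if_then_else_)
open import Data.Nat.Base as ℕ using (ℕ; NonZero; _≤_; zero; suc; _+_; _*_; _<_; z≤n; s≤s)
import Data.Nat.Properties as ℕ
open import Data.Nat.Induction using (<-wellFounded)
open import Data.Integer.Base as ℤ using (ℤ; 0ℤ; -_)
import Data.Integer.Properties as ℤ
open import Data.Fin.Base using (Fin; zero; suc)
open import Data.Fin.Properties using (_≟_; any?; all?; ¬∀⟶∃¬)
open import Data.Fin.Subset using (Subset; _∈_; inside; outside; _∩_; _─_; _-_; ∣_∣; ⊥; ⁅_⁆; Empty; Nonempty)
open import Data.Fin.Subset.Properties
open import Data.Product.Base using (∃; _×_; _,_; proj₁; proj₂)
open import Data.Sum.Base using (_⊎_; inj₁; inj₂)
open import Data.Vec.Base using ([]; _∷_; lookup; here; there)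
open import Data.Vec.Properties using ([]=⇒lookup; lookup∘tabulate)
open import Data.Vec.Functional using (Vector; foldr; head; tail)
open import Function.Base using (_∘_)
open import Induction.WellFounded using (Acc; acc)
open import Relation.Binary.PropositionalEquality using (_≡_; _≢_; refl; sym; trans; cong; subst)
open import Relation.Nullary using (¬_; Dec; yes; no; does; contradiction)
open import Relation.Nullary.Decidable using (_×-dec_)
open import Relation.Unary using (Pred; Decidable)

-- Sums over subsets and cardinalities.

module _ {a ℓ} (M : CommutativeMonoid a ℓ) where
  open CommutativeMonoid M renaming (refl to ≈-refl; sym to ≈-sym; trans to ≈-trans)
  open Sum M using (sum)
  open CommutativeSemigroupProperties commutativeSemigroup using (x∙yz≈y∙xz)

  -- Taken over any commutative monoid so that a single removal lemma serves both `weight` and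
  -- `profit`, which unfold to instances of this sum.
  subsetSum : ∀ {n} → Vector Carrier n → Subset n → Carrier
  subsetSum f S = sum (λ i → if lookup S i then f i else ε)

  subsetSum-remove : ∀ {n} (f : Vector Carrier n) {S : Subset n} {i} → i ∈ S →
                     subsetSum f S ≈ f i ∙ subsetSum f (S - i)
  subsetSum-remove f {S = _ ∷ S} here =
    -- Removing `zero` turns the head into `outside`, which contributes `ε`, and leaves the tail as
    -- `S ─ ⊥`.
    ∙-congˡ (≈-trans (reflexive (sym (cong (subsetSum (f ∘ suc)) (p─⊥≡p S)))) (≈-sym (identityˡ _)))
  subsetSum-remove f (there i∈S) =
    ≈-trans (∙-congˡ (subsetSum-remove (f ∘ suc) i∈S)) (x∙yz≈y∙xz _ _ _)

x∈p⇒∣p∣≡1+∣p-x∣ : ∀ {n} {p : Subset n} {x} → x ∈ p → ∣ p ∣ ≡ suc ∣ p - x ∣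
x∈p⇒∣p∣≡1+∣p-x∣ {p = _ ∷ p} here = cong (suc ∘ ∣_∣) (sym (p─⊥≡p p))
x∈p⇒∣p∣≡1+∣p-x∣ {p = inside  ∷ p} (there x∈p) = cong suc (x∈p⇒∣p∣≡1+∣p-x∣ x∈p)
x∈p⇒∣p∣≡1+∣p-x∣ {p = outside ∷ p} (there x∈p) = x∈p⇒∣p∣≡1+∣p-x∣ x∈p

-- Turns the effect of a removal on a color count into a removal from the color's part of the set.
p─r∩q≡p∩q─r : ∀ {n} (p r q : Subset n) → (p ─ r) ∩ q ≡ (p ∩ q) ─ r
p─r∩q≡p∩q─r []      []            []      = refl
p─r∩q≡p∩q─r (x ∷ p) (inside  ∷ r) (y ∷ q) = cong (outside ∷_) (p─r∩q≡p∩q─r p r q)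
p─r∩q≡p∩q─r (x ∷ p) (outside ∷ r) (y ∷ q) = cong (_ ∷_) (p─r∩q≡p∩q─r p r q)

-- Used for two distinct color classes: if one holds at least half of `p`, the other holds at most
-- half.
∣p∩q∣+∣p∩r∣≤∣p∣ : ∀ {n} (p q r : Subset n) → Empty (q ∩ r) → ∣ p ∩ q ∣ + ∣ p ∩ r ∣ ≤ ∣ p ∣
∣p∩q∣+∣p∩r∣≤∣p∣ []            []            []            _ = z≤n
∣p∩q∣+∣p∩r∣≤∣p∣ (outside ∷ p) (x ∷ q)       (y ∷ r)       e = ∣p∩q∣+∣p∩r∣≤∣p∣ p q r (drop-∷-Empty e)
∣p∩q∣+∣p∩r∣≤∣p∣ (inside ∷ p)  (inside ∷ q)  (inside ∷ r)  e = contradiction (zero , here) e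
∣p∩q∣+∣p∩r∣≤∣p∣ (inside ∷ p)  (inside ∷ q)  (outside ∷ r) e = s≤s (∣p∩q∣+∣p∩r∣≤∣p∣ p q r (drop-∷-Empty e))
∣p∩q∣+∣p∩r∣≤∣p∣ (inside ∷ p)  (outside ∷ q) (inside ∷ r)  e
  rewrite ℕ.+-suc ∣ p ∩ q ∣ ∣ p ∩ r ∣ = s≤s (∣p∩q∣+∣p∩r∣≤∣p∣ p q r (drop-∷-Empty e))
∣p∩q∣+∣p∩r∣≤∣p∣ (inside ∷ p)  (outside ∷ q) (outside ∷ r) e =
  ℕ.m≤n⇒m≤1+n (∣p∩q∣+∣p∩r∣≤∣p∣ p q r (drop-∷-Empty e))

0<∣p∣⇒nonempty : ∀ {n} (p : Subset n) → 0 < ∣ p ∣ → Nonempty p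
0<∣p∣⇒nonempty {n} p 0<∣p∣ with nonempty? p
... | yes ne = ne
... | no  ¬ne = contradiction (trans (cong ∣_∣ (Empty-unique ¬ne)) (∣⊥∣≡0 n)) (ℕ.>⇒≢ 0<∣p∣)

-- Bounds on folded maxima.

≤-foldr-⊔ : ∀ {n} (v : Vector ℕ n) i → v i ≤ foldr ℕ._⊔_ 0 v
≤-foldr-⊔ v zero    = ℕ.m≤m⊔n _ _
≤-foldr-⊔ v (suc i) = ℕ.m≤n⇒m≤o⊔n (v zero) (≤-foldr-⊔ (v ∘ suc) i)

-- Multiplication distributes over `⊔`, so a bound on `2 * d S` splits into one bound per color.
*-foldr-⊔-lub : ∀ {n x} a (v : Vector ℕ n) → (∀ i → a * v i ≤ x) → a * foldr ℕ._⊔_ 0 v ≤ x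
*-foldr-⊔-lub {zero}  a v av≤x rewrite ℕ.*-zeroʳ a = z≤n
*-foldr-⊔-lub {suc n} a v av≤x
  rewrite ℕ.*-distribˡ-⊔ a (v zero) (foldr ℕ._⊔_ 0 (v ∘ suc)) =
  ℕ.⊔-lub (av≤x zero) (*-foldr-⊔-lub a (v ∘ suc) (av≤x ∘ suc))

≤-maximum : ∀ {n} .{{_ : NonZero n}} (v : Vector ℤ n) i → v i ℤ.≤ maximum v
≤-maximum {suc n} v = λ { zero → init≤ (tail v) ; (suc i) → entry≤ (tail v) i }
  where
  -- The first entry enters `maximum` as the initial value of the fold, which stays `head v` while
  -- the induction runs over `u`.
  init≤ : ∀ {k} (u : Vector ℤ k) → head v ℤ.≤ foldr ℤ._⊔_ (head v) u
  init≤ {zero}  u = ℤ.≤-refl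
  init≤ {suc k} u = ℤ.i≤j⇒i≤k⊔j (u zero) (init≤ (u ∘ suc))

  entry≤ : ∀ {k} (u : Vector ℤ k) i → u i ℤ.≤ foldr ℤ._⊔_ (head v) u
  entry≤ u zero    = ℤ.i≤i⊔j _ _
  entry≤ u (suc i) = ℤ.i≤j⇒i≤k⊔j (u zero) (entry≤ (u ∘ suc) i)

-- Maximisation over all subsets.

Maximiser : ∀ {n ℓ} → Pred (Subset n) ℓ → (Subset n → ℤ) → Set ℓ
Maximiser P f = ∃ λ S → P S × (∀ T → P T → f T ℤ.≤ f S)

-- Exhaustive search: subsets with and without the first element are searched separately, and the
-- better of the two winners is kept.
maximiser? : ∀ {n ℓ} {P : Pred (Subset n) ℓ} → Decidable P → (f : Subset n → ℤ) →
             (∀ S → ¬ P S) ⊎ Maximiser P f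
maximiser? {zero} P? f with P? []
... | yes P[] = inj₂ ([] , P[] , λ { [] _ → ℤ.≤-refl })
... | no ¬P[] = inj₁ λ { [] → ¬P[] }
maximiser? {suc n} P? f
  with maximiser? (P? ∘ (inside ∷_)) (f ∘ (inside ∷_))
     | maximiser? (P? ∘ (outside ∷_)) (f ∘ (outside ∷_))
... | inj₁ ¬in            | inj₁ ¬out = inj₁ λ { (inside ∷ S) → ¬in S ; (outside ∷ S) → ¬out S }
... | inj₂ (S , PS , max) | inj₁ ¬out =
  inj₂ (_ , PS , λ { (inside ∷ T) → max T ; (outside ∷ T) PT → contradiction PT (¬out T) })
... | inj₁ ¬in            | inj₂ (S , PS , max) =
  inj₂ (_ , PS , λ { (inside ∷ T) PT → contradiction PT (¬in T) ; (outside ∷ T) → max T })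
... | inj₂ (S , PS , max) | inj₂ (S′ , PS′ , max′) with ℤ.≤-total (f (inside ∷ S)) (f (outside ∷ S′))
...   | inj₁ ≤′ = inj₂ (_ , PS′ , λ { (inside ∷ T) PT → ℤ.≤-trans (max T PT) ≤′ ; (outside ∷ T) → max′ T })
...   | inj₂ ≥′ = inj₂ (_ , PS , λ { (inside ∷ T) → max T ; (outside ∷ T) PT → ℤ.≤-trans (max′ T PT) ≥′ })

-- Feasible and optimal solutions.

module _ {n m : ℕ} (I : ColKP n m) where
  open ColKP I

  -- The color constraint stated color by color, so that a violation yields a specific color.
  Balanced : Subset n → Set
  Balanced S = ∀ c → 2 * k c S ≤ ∣ S ∣ + 1

  balanced⇒2d≤ : ∀ S → Balanced S → 2 * d S ≤ ∣ S ∣ + 1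
  balanced⇒2d≤ S = *-foldr-⊔-lub 2 (λ c → k c S)

  2d≤⇒balanced : ∀ S → 2 * d S ≤ ∣ S ∣ + 1 → Balanced S
  2d≤⇒balanced S 2d≤ c = ℕ.≤-trans (ℕ.*-monoʳ-≤ 2 (≤-foldr-⊔ (λ c → k c S) c)) 2d≤

  feasible? : Decidable Feasible
  feasible? S = (weight S ℕ.≤? b) ×-dec (2 * d S ℕ.≤? ∣ S ∣ + 1)

  weight-⊥ : weight ⊥ ≡ 0
  weight-⊥ = go w
    where
    go : ∀ {n} (f : Vector ℕ n) → subsetSum ℕ.+-0-commutativeMonoid f ⊥ ≡ 0
    go {zero}  f = refl
    go {suc n} f = go (f ∘ suc)

  feasible-⊥ : Feasible ⊥
  feasible-⊥ = subst (_≤ b) (sym weight-⊥) z≤n , balanced⇒2d≤ ⊥ bal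
    where
    bal : Balanced ⊥
    bal c = ℕ.≤-trans (ℕ.*-monoʳ-≤ 2 (subst (k c ⊥ ≤_) (∣⊥∣≡0 n) (∣p∩q∣≤∣p∣ ⊥ (colorClass c)))) z≤n

  optimal-exists : ∃ Optimal
  optimal-exists with maximiser? feasible? profit
  ... | inj₁ ¬feasible = contradiction feasible-⊥ (¬feasible ⊥)
  ... | inj₂ optimal   = optimal

  -- Removing items from a solution.

  ∈-colorClass⁻ : ∀ {c i} → i ∈ colorClass c → κ i ≡ c
  ∈-colorClass⁻ {c} {i} i∈ with κ i ≟ c | trans (sym (lookup∘tabulate (λ i → does (κ i ≟ c)) i)) ([]=⇒lookup i∈)
  ... | yes eq | _ = eq
  ... | no  _  | ()

  colorClass-disjoint : ∀ {c c′} → c ≢ c′ → Empty (colorClass c ∩ colorClass c′)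
  colorClass-disjoint c≢c′ (i , i∈) with x∈p∩q⁻ _ _ i∈
  ... | i∈c , i∈c′ = c≢c′ (trans (sym (∈-colorClass⁻ i∈c)) (∈-colorClass⁻ i∈c′))

  k-remove-< : ∀ {c j S} → j ∈ S ∩ colorClass c → k c (S - j) < k c S
  k-remove-< {c} {j} {S} j∈ rewrite p─r∩q≡p∩q─r S ⁅ j ⁆ (colorClass c) = x∈p⇒∣p-x∣<∣p∣ j∈

  k-remove-≤ : ∀ c j S → k c (S - j) ≤ k c S
  k-remove-≤ c j S rewrite p─r∩q≡p∩q─r S ⁅ j ⁆ (colorClass c) =
    ∣p─q∣≤∣p∣ (S ∩ colorClass c) ⁅ j ⁆

  weight-remove-≤ : ∀ {i S} → i ∈ S → weight (S - i) ≤ weight S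
  weight-remove-≤ {i} i∈S rewrite subsetSum-remove ℕ.+-0-commutativeMonoid w i∈S = ℕ.m≤n+m _ (w i)

  profit-remove : ∀ {i S} → i ∈ S → profit S ≡ p i ℤ.+ profit (S - i)
  profit-remove = subsetSum-remove ℤ.+-0-commutativeMonoid p

  -- The hypotheses force `2 * k c T` to equal `∣ T ∣ + 2`. Losing `j` lowers this by two, and any
  -- other color holds less than half of `T`.
  balanced-remove-majority : ∀ {c j T} → ∣ T ∣ + 1 < 2 * k c T → 2 * k c T ≤ ∣ T ∣ + 2 →
                             j ∈ T ∩ colorClass c → Balanced (T - j)
  balanced-remove-majority {c} {j} {T} |T|+1<2k 2k≤|T|+2 j∈ c′ = begin
    2 * k c′ (T - j)  ≤⟨ bound (c′ ≟ c) ⟩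
    ∣ T ∣             ≡⟨ x∈p⇒∣p∣≡1+∣p-x∣ (p∩q⊆p T (colorClass c) j∈) ⟩
    suc ∣ T - j ∣     ≡⟨ ℕ.+-comm 1 ∣ T - j ∣ ⟩
    ∣ T - j ∣ + 1     ∎
    where
    open ℕ.≤-Reasoning
    bound : Dec (c′ ≡ c) → 2 * k c′ (T - j) ≤ ∣ T ∣
    bound (yes refl) = ℕ.+-cancelʳ-≤ 2 _ _ (begin
      2 * k c (T - j) + 2    ≡⟨ ℕ.+-comm _ 2 ⟩
      2 + 2 * k c (T - j)    ≡⟨ ℕ.*-suc 2 (k c (T - j)) ⟨
      2 * suc (k c (T - j))  ≤⟨ ℕ.*-monoʳ-≤ 2 (k-remove-< {S = T} j∈) ⟩
      2 * k c T              ≤⟨ 2k≤|T|+2 ⟩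
      ∣ T ∣ + 2              ∎)
    -- The added `∣ T ∣` is traded for the larger `2 * k c T`, so that disjointness of the two
    -- classes applies.
    bound (no c′≢c) = ℕ.+-cancelʳ-≤ ∣ T ∣ _ _ (begin
      2 * k c′ (T - j) + ∣ T ∣    ≤⟨ ℕ.+-mono-≤ (ℕ.*-monoʳ-≤ 2 (k-remove-≤ c′ j T))
                                      (ℕ.≤-trans (ℕ.m≤m+n ∣ T ∣ 1) (ℕ.<⇒≤ |T|+1<2k)) ⟩
      2 * k c′ T + 2 * k c T      ≡⟨ ℕ.*-distribˡ-+ 2 (k c′ T) (k c T) ⟨
      2 * (k c′ T + k c T)        ≤⟨ ℕ.*-monoʳ-≤ 2 (∣p∩q∣+∣p∩r∣≤∣p∣ T _ _ (colorClass-disjoint c′≢c)) ⟩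
      2 * ∣ T ∣                   ≡⟨ cong (∣ T ∣ +_) (ℕ.+-identityʳ ∣ T ∣) ⟩
      ∣ T ∣ + ∣ T ∣               ∎)

  drop-costly : .{{_ : NonZero n}} → 0ℤ ℤ.< maximum p → ∀ {S i} → Feasible S → i ∈ S →
                p i ℤ.≤ - maximum p → ∃ λ T → Feasible T × ∣ T ∣ < ∣ S ∣ × profit S ℤ.≤ profit T
  drop-costly 0<M {S} {i} (w≤b , 2d≤) i∈S pᵢ≤-M with all? (λ c → 2 * k c (S - i) ℕ.≤? ∣ S - i ∣ + 1)
  ... | yes bal =
    S - i , (ℕ.≤-trans (weight-remove-≤ i∈S) w≤b , balanced⇒2d≤ (S - i) bal) , x∈p⇒∣p-x∣<∣p∣ i∈S , (begin
      profit S                ≡⟨ profit-remove i∈S ⟩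
      -- Since `maximum p` is positive, `p i` is at most zero.
      p i ℤ.+ profit (S - i)  ≤⟨ ℤ.+-monoˡ-≤ _ (ℤ.≤-trans pᵢ≤-M (ℤ.neg-mono-≤ (ℤ.<⇒≤ 0<M))) ⟩
      0ℤ ℤ.+ profit (S - i)   ≡⟨ ℤ.+-identityˡ _ ⟩
      profit (S - i)          ∎)
    where open ℤ.≤-Reasoning
  ... | no ¬bal with ¬∀⟶∃¬ m _ (λ c → 2 * k c (S - i) ℕ.≤? ∣ S - i ∣ + 1) ¬bal
  -- The violated bound makes `2 * k c (S - i)` positive, so an item `j` of color `c` remains.
  ...   | c , 2k≰ with 0<∣p∣⇒nonempty ((S - i) ∩ colorClass c)
                         (ℕ.*-cancelˡ-< 2 0 _ (ℕ.≤-<-trans z≤n (ℕ.≰⇒> 2k≰)))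
  ...     | j , j∈ =
    U , (ℕ.≤-trans (weight-remove-≤ j∈T) (ℕ.≤-trans (weight-remove-≤ i∈S) w≤b) , balanced⇒2d≤ U balU) ,
    ℕ.<-trans (x∈p⇒∣p-x∣<∣p∣ j∈T) (x∈p⇒∣p-x∣<∣p∣ i∈S) , profit≤
    where
    T U : Subset n
    T = S - i
    U = T - j

    j∈T : j ∈ T
    j∈T = p∩q⊆p T (colorClass c) j∈

    -- Balance of `S` allows `∣ S ∣ + 1`, and `S` has one item more than `T`; hence the excess is at
    -- most 2.
    2k≤ : 2 * k c T ≤ ∣ T ∣ + 2
    2k≤ = begin
      2 * k c T       ≤⟨ ℕ.*-monoʳ-≤ 2 (k-remove-≤ c i S) ⟩
      2 * k c S       ≤⟨ 2d≤⇒balanced S 2d≤ c ⟩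
      ∣ S ∣ + 1       ≡⟨ cong (_+ 1) (x∈p⇒∣p∣≡1+∣p-x∣ i∈S) ⟩
      suc ∣ T ∣ + 1   ≡⟨ ℕ.+-suc ∣ T ∣ 1 ⟨
      ∣ T ∣ + 2       ∎
      where open ℕ.≤-Reasoning

    balU : Balanced U
    balU = balanced-remove-majority (ℕ.≰⇒> 2k≰) 2k≤ j∈

    profit≤ : profit S ℤ.≤ profit U
    profit≤ = begin
      profit S                                  ≡⟨ profit-remove i∈S ⟩
      p i ℤ.+ profit T                          ≡⟨ cong (λ x → p i ℤ.+ x) (profit-remove j∈T) ⟩
      p i ℤ.+ (p j ℤ.+ profit U)                ≡⟨ ℤ.+-assoc (p i) (p j) (profit U) ⟨
      (p i ℤ.+ p j) ℤ.+ profit U                ≤⟨ ℤ.+-monoˡ-≤ _ (ℤ.+-mono-≤ pᵢ≤-M (≤-maximum p j)) ⟩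
      (- maximum p ℤ.+ maximum p) ℤ.+ profit U  ≡⟨ cong (ℤ._+ profit U) (ℤ.+-inverseˡ (maximum p)) ⟩
      0ℤ ℤ.+ profit U                           ≡⟨ ℤ.+-identityˡ _ ⟩
      profit U                                  ∎
      where open ℤ.≤-Reasoning

lemma2p3 : ∀ {n m : ℕ} .{{_ : NonZero n}} (I : ColKP n m) →
    let open ColKP I in
    (∀ i → w i ≤ b) →
    0ℤ ℤ.< maximum p →
    ∃ λ (S : Subset n) → Optimal S × (∀ (i : Fin n) → i ∈ S → ¬ (p i ℤ.≤ - maximum p))
lemma2p3 {n} I _ 0<M = shrink (proj₁ opt) (<-wellFounded _) (proj₂ opt)
  where
  open ColKP I

  opt : ∃ Optimal
  opt = optimal-exists I

  shrink : ∀ S → Acc _<_ ∣ S ∣ → Optimal S →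
           ∃ λ (S : Subset n) → Optimal S × (∀ (i : Fin n) → i ∈ S → ¬ (p i ℤ.≤ - maximum p))
  shrink S (acc rec) (feas , max) with any? (λ i → (i ∈? S) ×-dec (p i ℤ.≤? - maximum p))
  ... | no ¬costly = S , (feas , max) , λ i i∈S pᵢ≤ → ¬costly (i , i∈S , pᵢ≤)
  ... | yes (i , i∈S , pᵢ≤) with drop-costly I 0<M feas i∈S pᵢ≤
  ...   | T , feasT , ∣T∣<∣S∣ , profit≤ =
    -- Optimality passes to `T`, whose profit is at least that of the optimal `S`.
    shrink T (rec ∣T∣<∣S∣) (feasT , λ R feasR → ℤ.≤-trans (max R feasR) profit≤)
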